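{- Let $m \ge 4$ and $n \ge 3$ be integers and let $d$ be a positive integer. Then there exists a matrix $A \in \mathbb{R}^{[m]\times[n]}$ such that (i) $A$ does not have an elimination ordering, and (ii) for every vector $b \in \mathbb{R}^{[m]}$, the solution graph $G(R(A,b))$ is connected.
   Context: Fix a positive integer $d$ and let $D=\{0,1,\dots,d\}$; $[n]=\{1,\dots,n\}$. For $A\in\mathbb{R}^{[m]\times[n]}$ and $b\in\mathbb{R}^{[m]}$, $R(A,b)=\{x\in D^{[n]} : Ax\ge b\}$ is the set of feasible solutions of the integer linear system $(A,b)$. For $R\subseteq D^{[n]}$, the solution graph $G(R)$ is the undirected graph with vertex set $R$ in which $x,y$ are adjacent iff they differ in exactly one coordinate (Hamming distance $1$). A matrix $A=(a_{ij})$ with column index set $J$ can be eliminated at column $j\in J$ if (i) for every row $i$ with $a_{ij}>0$ we have $a_{ij'}=0$ for all $j'\in J\setminus\{j\}$, or (ii) for every row $i$ with $a_{ij}<0$ we have $a_{ij'}=0$ for all $j'\in J\setminus\{j\}$. For $J'\subseteq [n]$, $\mathrm{elm}(A,J')$ denotes the submatrix of $A$ obtained by deleting the columns indexed by $J'$. A sequence $(j_1,\dots,j_n)$ of the elements of $[n]$ is an elimination ordering (EO) of $A\in\mathbb{R}^{[m]\times[n]}$ if for every $t\in[n]$ the matrix $\mathrm{elm}(A,\{j_1,\dots,j_{t-1}\})$ can be eliminated at column $j_t$. -}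

module Defs where

open import Algebra.Bundles.Raw using (RawMonoid)
import Algebra.Definitions.RawMonoid as RawMonoidDefinitions
open import Data.Fin.Base as Fin using (Fin; toℕ)
import Data.Fin.Properties as Fin
open import Data.Fin.Permutation using (Permutation′; _⟨$⟩ʳ_; _⟨$⟩ˡ_; inverseˡ)
open import Data.Integer.Base using (+_)
open import Data.Irrelevant using ([_])
open import Data.Nat.Base as ℕ using (ℕ; suc)
import Data.Nat.Properties as ℕ
open import Data.Product.Base using (∃; ∃₂; _×_; _,_)
open import Data.Product using (∃!)
open import Data.Rational.Base as ℚ using (ℚ; 0ℚ; 1ℚ; ½; ∣_∣)
import Data.Rational.Properties as ℚ
open import Data.Rational.Solver using (module +-*-Solver)
open import Data.Refinement using (Refinement; Refinement-syntax; value; _,_)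
open import Data.Sum.Base using (_⊎_)
open import Data.Vec.Base using (Vec; lookup)
open import Data.Vec.Functional using (Vector)
open import Function.Base using (_∘_)
open import Level using (0ℓ)
open import Relation.Binary.Construct.Closure.ReflexiveTransitive using (Star)
open import Relation.Binary.Core using (Rel)
open import Relation.Binary.Definitions using (Symmetric; Irreflexive)
open import Relation.Binary.PropositionalEquality
  using (_≡_; _≢_; refl; sym; trans; cong; subst)
open import Relation.Unary using (Pred; _∈_; _∉_)

-- Real numbers as Cauchy sequences of rationals; equality is the
-- relation _≈_.
module Real where

  Cauchy : (ℕ → ℚ) → Set
  Cauchy f = ∀ ε → 0ℚ ℚ.< ε →
    ∃ λ N → ∀ m n → N ℕ.≤ m → N ℕ.≤ n → ∣ f m ℚ.- f n ∣ ℚ.< ε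

  record ℝ : Set where
    constructor mkℝ
    field
      seq    : ℕ → ℚ
      cauchy : Cauchy seq

  open ℝ public

  infix  4 _≈_ _<_ _>_ _≤_ _≥_
  infixl 6 _+_
  infixl 7 _*_

  _≈_ : Rel ℝ 0ℓ
  x ≈ y = ∀ ε → 0ℚ ℚ.< ε →
    ∃ λ N → ∀ n → N ℕ.≤ n → ∣ seq x n ℚ.- seq y n ∣ ℚ.< ε

  _<_ : Rel ℝ 0ℓ
  x < y = ∃ λ ε → 0ℚ ℚ.< ε ×
    ∃ λ N → ∀ n → N ℕ.≤ n → seq x n ℚ.+ ε ℚ.< seq y n

  _≤_ : Rel ℝ 0ℓ
  x ≤ y = ∀ ε → 0ℚ ℚ.< ε →
    ∃ λ N → ∀ n → N ℕ.≤ n → seq x n ℚ.< seq y n ℚ.+ ε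

  _>_ _≥_ : Rel ℝ 0ℓ
  x > y = y < x
  x ≥ y = y ≤ x

  fromℚ : ℚ → ℝ
  fromℚ q = mkℝ (λ _ → q) λ ε 0<ε → 0 , λ _ _ _ _ →
    subst (λ p → ∣ p ∣ ℚ.< ε) (sym (ℚ.+-inverseʳ q)) 0<ε

  fromℕ : ℕ → ℝ
  fromℕ k = fromℚ (+ k ℚ./ 1)

  0ℝ : ℝ
  0ℝ = fromℚ 0ℚ

  private
    open +-*-Solver using (solve; _:=_; _:+_; _:*_; _:-_; con)

    *-pos : ∀ {p q} → 0ℚ ℚ.< p → 0ℚ ℚ.< q → 0ℚ ℚ.< p ℚ.* q
    *-pos {p} {q} 0<p 0<q = subst (ℚ._< p ℚ.* q) (ℚ.*-zeroʳ p)
      (ℚ.*-monoʳ-<-pos p {{ℚ.positive 0<p}} 0<q)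

    half-pos : ∀ {ε} → 0ℚ ℚ.< ε → 0ℚ ℚ.< ½ ℚ.* ε
    half-pos = *-pos (ℚ.positive⁻¹ ½)

    half+half : ∀ ε → ½ ℚ.* ε ℚ.+ ½ ℚ.* ε ≡ ε
    half+half = solve 1 (λ e → con ½ :* e :+ con ½ :* e := e) refl

    bounded : ∀ f → Cauchy f →
      ∃₂ λ B N → 0ℚ ℚ.< B × (∀ n → N ℕ.≤ n → ∣ f n ∣ ℚ.≤ B)
    bounded f cf with cf 1ℚ (ℚ.positive⁻¹ 1ℚ)
    ... | N , close = 1ℚ ℚ.+ ∣ f N ∣ , N , B-pos , λ n N≤n → begin
        ∣ f n ∣                        ≡⟨ cong ∣_∣ (split (f n) (f N)) ⟩
        ∣ (f n ℚ.- f N) ℚ.+ f N ∣      ≤⟨ ℚ.∣p+q∣≤∣p∣+∣q∣ (f n ℚ.- f N) (f N) ⟩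
        ∣ f n ℚ.- f N ∣ ℚ.+ ∣ f N ∣    ≤⟨ ℚ.+-monoˡ-≤ ∣ f N ∣ (ℚ.<⇒≤ (close n N N≤n ℕ.≤-refl)) ⟩
        1ℚ ℚ.+ ∣ f N ∣                 ∎
      where
      open ℚ.≤-Reasoning
      split : ∀ p q → p ≡ (p ℚ.- q) ℚ.+ q
      split = solve 2 (λ p q → p := (p :- q) :+ q) refl
      B-pos : 0ℚ ℚ.< 1ℚ ℚ.+ ∣ f N ∣
      B-pos = ℚ.+-mono-<-≤ (ℚ.positive⁻¹ 1ℚ) (ℚ.0≤∣p∣ (f N))

    +-cauchy : ∀ f g → Cauchy f → Cauchy g → Cauchy (λ n → f n ℚ.+ g n)
    +-cauchy f g cf cg ε 0<ε
      with cf (½ ℚ.* ε) (half-pos 0<ε) | cg (½ ℚ.* ε) (half-pos 0<ε)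
    ... | M , cM | N , cN = M ℕ.⊔ N , λ m n ≤m ≤n → begin-strict
        ∣ (f m ℚ.+ g m) ℚ.- (f n ℚ.+ g n) ∣
          ≡⟨ cong ∣_∣ (regroup (f m) (g m) (f n) (g n)) ⟩
        ∣ (f m ℚ.- f n) ℚ.+ (g m ℚ.- g n) ∣
          ≤⟨ ℚ.∣p+q∣≤∣p∣+∣q∣ (f m ℚ.- f n) (g m ℚ.- g n) ⟩
        ∣ f m ℚ.- f n ∣ ℚ.+ ∣ g m ℚ.- g n ∣
          <⟨ ℚ.+-mono-< (cM m n (ℕ.m⊔n≤o⇒m≤o M N ≤m) (ℕ.m⊔n≤o⇒m≤o M N ≤n))
                        (cN m n (ℕ.m⊔n≤o⇒n≤o M N ≤m) (ℕ.m⊔n≤o⇒n≤o M N ≤n)) ⟩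
        ½ ℚ.* ε ℚ.+ ½ ℚ.* ε
          ≡⟨ half+half ε ⟩
        ε ∎
      where
      open ℚ.≤-Reasoning
      regroup : ∀ a b c d → (a ℚ.+ b) ℚ.- (c ℚ.+ d) ≡ (a ℚ.- c) ℚ.+ (b ℚ.- d)
      regroup = solve 4 (λ a b c d → (a :+ b) :- (c :+ d) := (a :- c) :+ (b :- d)) refl

    -- For a bound B > 0, a tolerance δ > 0 with B δ = ε / 2.
    tolerance : ∀ {B ε} → 0ℚ ℚ.< B → 0ℚ ℚ.< ε →
      ∃ λ δ → 0ℚ ℚ.< δ × B ℚ.* δ ≡ ½ ℚ.* ε
    tolerance {B} {ε} 0<B 0<ε =
      B⁻¹ ℚ.* (½ ℚ.* ε) ,
      *-pos (ℚ.positive⁻¹ B⁻¹ {{ℚ.1/pos⇒pos B}}) (half-pos 0<ε) ,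
      trans (sym (ℚ.*-assoc B B⁻¹ (½ ℚ.* ε)))
        (trans (cong (ℚ._* (½ ℚ.* ε)) (ℚ.*-inverseʳ B)) (ℚ.*-identityˡ (½ ℚ.* ε)))
      where
      instance
        B-positive : ℚ.Positive B
        B-positive = ℚ.positive 0<B
        B-nonZero : ℚ.NonZero B
        B-nonZero = ℚ.pos⇒nonZero B
      B⁻¹ : ℚ
      B⁻¹ = ℚ.1/ B

    *-small : ∀ {B δ η} p q → 0ℚ ℚ.< B → ∣ p ∣ ℚ.≤ B → ∣ q ∣ ℚ.< δ →
      B ℚ.* δ ≡ η → ∣ p ℚ.* q ∣ ℚ.< η
    *-small {B} {δ} {η} p q 0<B p≤B q<δ Bδ≡η = begin-strict
        ∣ p ℚ.* q ∣        ≡⟨ ℚ.∣p*q∣≡∣p∣*∣q∣ p q ⟩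
        ∣ p ∣ ℚ.* ∣ q ∣    ≤⟨ ℚ.*-monoʳ-≤-nonNeg ∣ q ∣ {{ℚ.∣-∣-nonNeg q}} p≤B ⟩
        B ℚ.* ∣ q ∣        <⟨ ℚ.*-monoʳ-<-pos B {{ℚ.positive 0<B}} q<δ ⟩
        B ℚ.* δ            ≡⟨ Bδ≡η ⟩
        η                  ∎
      where open ℚ.≤-Reasoning

    *-close : ∀ {B C γ δ ε} p q r s → 0ℚ ℚ.< B → 0ℚ ℚ.< C →
      ∣ p ∣ ℚ.≤ B → ∣ s ∣ ℚ.≤ C → ∣ q ℚ.- s ∣ ℚ.< γ → ∣ p ℚ.- r ∣ ℚ.< δ →
      B ℚ.* γ ≡ ½ ℚ.* ε → C ℚ.* δ ≡ ½ ℚ.* ε →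
      ∣ p ℚ.* q ℚ.- r ℚ.* s ∣ ℚ.< ε
    *-close {ε = ε} p q r s 0<B 0<C p≤B s≤C qs<γ pr<δ Bγ Cδ = begin-strict
        ∣ p ℚ.* q ℚ.- r ℚ.* s ∣
          ≡⟨ cong ∣_∣ (regroup p q r s) ⟩
        ∣ p ℚ.* (q ℚ.- s) ℚ.+ s ℚ.* (p ℚ.- r) ∣
          ≤⟨ ℚ.∣p+q∣≤∣p∣+∣q∣ (p ℚ.* (q ℚ.- s)) (s ℚ.* (p ℚ.- r)) ⟩
        ∣ p ℚ.* (q ℚ.- s) ∣ ℚ.+ ∣ s ℚ.* (p ℚ.- r) ∣
          <⟨ ℚ.+-mono-< (*-small p (q ℚ.- s) 0<B p≤B qs<γ Bγ)
                        (*-small s (p ℚ.- r) 0<C s≤C pr<δ Cδ) ⟩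
        ½ ℚ.* ε ℚ.+ ½ ℚ.* ε
          ≡⟨ half+half ε ⟩
        ε ∎
      where
      open ℚ.≤-Reasoning
      regroup : ∀ a b c d →
        a ℚ.* b ℚ.- c ℚ.* d ≡ a ℚ.* (b ℚ.- d) ℚ.+ d ℚ.* (a ℚ.- c)
      regroup = solve 4 (λ a b c d →
        a :* b :- c :* d := a :* (b :- d) :+ d :* (a :- c)) refl

    *-cauchy : ∀ f g → Cauchy f → Cauchy g → Cauchy (λ n → f n ℚ.* g n)
    *-cauchy f g cf cg ε 0<ε =
      let B , K , 0<B , f≤B = bounded f cf
          C , L , 0<C , g≤C = bounded g cg
          γ , 0<γ , Bγ = tolerance 0<B 0<ε
          δ , 0<δ , Cδ = tolerance 0<C 0<ε
          M , cM = cf δ 0<δ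
          N , cN = cg γ 0<γ
      in (K ℕ.⊔ L) ℕ.⊔ (M ℕ.⊔ N) , λ m n ≤m ≤n →
        let KL≤m = ℕ.m⊔n≤o⇒m≤o (K ℕ.⊔ L) (M ℕ.⊔ N) ≤m
            KL≤n = ℕ.m⊔n≤o⇒m≤o (K ℕ.⊔ L) (M ℕ.⊔ N) ≤n
            MN≤m = ℕ.m⊔n≤o⇒n≤o (K ℕ.⊔ L) (M ℕ.⊔ N) ≤m
            MN≤n = ℕ.m⊔n≤o⇒n≤o (K ℕ.⊔ L) (M ℕ.⊔ N) ≤n
        in *-close (f m) (g m) (f n) (g n) 0<B 0<C
             (f≤B m (ℕ.m⊔n≤o⇒m≤o K L KL≤m))
             (g≤C n (ℕ.m⊔n≤o⇒n≤o K L KL≤n))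
             (cN m n (ℕ.m⊔n≤o⇒n≤o M N MN≤m) (ℕ.m⊔n≤o⇒n≤o M N MN≤n))
             (cM m n (ℕ.m⊔n≤o⇒m≤o M N MN≤m) (ℕ.m⊔n≤o⇒m≤o M N MN≤n))
             Bγ Cδ

  _+_ : ℝ → ℝ → ℝ
  x + y = mkℝ (λ n → seq x n ℚ.+ seq y n) (+-cauchy (seq x) (seq y) (cauchy x) (cauchy y))

  _*_ : ℝ → ℝ → ℝ
  x * y = mkℝ (λ n → seq x n ℚ.* seq y n) (*-cauchy (seq x) (seq y) (cauchy x) (cauchy y))

  +-rawMonoid : RawMonoid 0ℓ 0ℓ
  +-rawMonoid = record { Carrier = ℝ ; _≈_ = _≈_ ; _∙_ = _+_ ; ε = 0ℝ }

  open RawMonoidDefinitions +-rawMonoid public using (sum)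

open Real public using (ℝ)

-- A matrix whose rows and columns are indexed by arbitrary sets; elimination
-- is applied to matrices whose column index set is a subset of Fin n.
Matrix : Set → Set → Set
Matrix I J = I → J → ℝ

D : ℕ → Set
D d = Fin (suc d)

infixl 7 _·_

_·_ : ∀ {m n d} → Matrix (Fin m) (Fin n) → Vec (D d) n → Vector ℝ m
(A · x) i = Real.sum λ j → A i j Real.* Real.fromℕ (toℕ (lookup x j))

R : ∀ {m n} d → Matrix (Fin m) (Fin n) → Vector ℝ m → Pred (Vec (D d) n) 0ℓ
R d A b x = ∀ i → (A · x) i Real.≥ b i

-- An undirected simple graph whose vertices are the elements of V satisfying
-- Vertex.  Vertex is a predicate rather than a Σ-type so that two proofs of
-- membership do not give two vertices.
record Graph (V : Set) : Set₁ where
  field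
    Vertex     : Pred V 0ℓ
    Adj        : Rel V 0ℓ
    Adj-sym    : Symmetric Adj
    Adj-irrefl : Irreflexive _≡_ Adj

-- Any two vertices are joined by a walk through vertices; in particular the
-- graph without vertices is connected.
Connected : ∀ {V} → Graph V → Set
Connected Γ = ∀ {x y} → x ∈ Vertex → y ∈ Vertex →
  Star (λ u v → u ∈ Vertex × v ∈ Vertex × Adj u v) x y
  where open Graph Γ

DifferInExactlyOne : ∀ {n d} → Rel (Vec (D d) n) 0ℓ
DifferInExactlyOne x y = ∃! _≡_ λ j → lookup x j ≢ lookup y j

G : ∀ {n d} → Pred (Vec (D d) n) 0ℓ → Graph (Vec (D d) n)
G S = record
  { Vertex     = S
  ; Adj        = DifferInExactlyOne
  ; Adj-sym    = λ (j , x≢y , unique) → j , x≢y ∘ sym , λ y≢x → unique (y≢x ∘ sym)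
  ; Adj-irrefl = λ { refl (j , x≢x , _) → x≢x refl }
  }

CanBeEliminatedAt : ∀ {I J} → Matrix I J → J → Set
CanBeEliminatedAt A j =
    (∀ i → A i j Real.> Real.0ℝ → ∀ j′ → j′ ≢ j → A i j′ Real.≈ Real.0ℝ)
  ⊎ (∀ i → A i j Real.< Real.0ℝ → ∀ j′ → j′ ≢ j → A i j′ Real.≈ Real.0ℝ)

-- The proof component of a refinement type is irrelevant, so remaining columns
-- are equal exactly when the underlying columns are.
elm : ∀ {I J} → Matrix I J → (J′ : Pred J 0ℓ) → Matrix I [ j ∈ J ∣ j ∉ J′ ]
elm A J′ i j = A i (value j)

Before : ∀ {n} → Permutation′ n → Fin n → Pred (Fin n) 0ℓ
Before σ t j = ∃ λ s → s Fin.< t × σ ⟨$⟩ʳ s ≡ j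

self∉Before : ∀ {n} (σ : Permutation′ n) t → σ ⟨$⟩ʳ t ∉ Before σ t
self∉Before σ t (s , s<t , σs≡σt) = Fin.<-irrefl s≡t s<t
  where
  s≡t : s ≡ t
  s≡t = trans (sym (inverseˡ σ)) (trans (cong (σ ⟨$⟩ˡ_) σs≡σt) (inverseˡ σ))

-- The sequence (j₁, …, jₙ) is encoded as the permutation t ↦ jₜ.
IsEliminationOrdering : ∀ {m n} → Matrix (Fin m) (Fin n) → Permutation′ n → Set
IsEliminationOrdering A σ = ∀ t →
  CanBeEliminatedAt (elm A (Before σ t)) (σ ⟨$⟩ʳ t , [ self∉Before σ t ])

HasEliminationOrdering : ∀ {m n} → Matrix (Fin m) (Fin n) → Set
HasEliminationOrdering A = ∃ λ σ → IsEliminationOrdering A σ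

{-# OPTIONS --safe #-}

-- The rows of A read y + x, y - x, z - y and -z - y, so A v ≥ b says
-- f(x) ≤ y ≤ g(z) for a convex f and a concave g.  Each of the columns x, y, z
-- has a positive and a negative entry in a row with a nonzero entry in another
-- of the three, so none of them can be the first to be eliminated.  Given two
-- solutions (x, y, z) and (x′, y′, z′) with y ≤ y′, the walk
-- (x, y, z) – (x, y, z′) – (x, y′, z′) – (x′, y′, z′) is feasible because
-- f(x) ≤ y ≤ y′ ≤ g(z′).
module Submission where

open import Defs
open import Data.Fin.Base using (Fin; zero; suc; toℕ)
import Data.Fin.Base as Fin
open import Data.Fin.Induction using (<-wellFounded)
open import Data.Fin.Patterns using (0F; 1F; 2F; 3F)
open import Data.Fin.Permutation using (_⟨$⟩ʳ_; _⟨$⟩ˡ_; inverseʳ)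
import Data.Fin.Properties as Fin
open import Data.Integer.Base using (+_; +≤+)
import Data.Integer.Properties as ℤ
open import Data.Irrelevant using ([_])
open import Data.Nat.Base as ℕ using (ℕ; zero; suc; _≤_; z≤n; s≤s)
import Data.Nat.Properties as ℕ
open import Data.Product.Base using (∃; ∃₂; _×_; _,_)
open import Data.Rational.Base as ℚ using (ℚ; 0ℚ; 1ℚ; ½)
import Data.Rational.Properties as ℚ
open import Data.Rational.Unnormalised.Base using (mkℚᵘ; *≤*)
import Data.Rational.Unnormalised.Properties as ℚᵘ
open import Data.Refinement using (value; _,_)
open import Data.Sum.Base using (inj₁; inj₂; [_,_]′)
open import Data.Vec.Base using (Vec; []; _∷_; lookup)
open import Data.Vec.Functional using (Vector)
open import Function.Base using (_∘_)
open import Induction.WellFounded using (Acc; acc)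
open import Level using (0ℓ)
open import Relation.Binary.Construct.Closure.ReflexiveTransitive
  using (Star; ε; _◅_; _◅◅_; gmap; reverse)
open import Relation.Binary.Core using (Rel)
open import Relation.Binary.PropositionalEquality
  using (_≡_; _≢_; refl; sym; trans; cong; subst)
open import Relation.Nullary.Decidable using (yes; no; from-yes)
open import Relation.Nullary.Negation.Core using (¬_; contradiction)
open import Relation.Unary using (Pred; _∈_; _∉_)

-- Monotonicity of the row sums

-- `+ a ℚ./ 1` normalises by a gcd that is stuck for variable `a`; the unnormalised fractions
-- compare directly.
fromℕ-mono-≤ : ∀ {a b} → a ≤ b → + a ℚ./ 1 ℚ.≤ + b ℚ./ 1
fromℕ-mono-≤ {a} {b} a≤b = ℚ.toℚᵘ-cancel-≤ (begin
    ℚ.toℚᵘ (+ a ℚ./ 1)  ≃⟨ ℚ.toℚᵘ-fromℚᵘ (mkℚᵘ (+ a) 0) ⟩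
    mkℚᵘ (+ a) 0        ≤⟨ *≤* (ℤ.*-monoʳ-≤-nonNeg (+ 1) (+≤+ a≤b)) ⟩
    mkℚᵘ (+ b) 0        ≃⟨ ℚ.toℚᵘ-fromℚᵘ (mkℚᵘ (+ b) 0) ⟨
    ℚ.toℚᵘ (+ b ℚ./ 1)  ∎)
  where open ℚᵘ.≤-Reasoning

infix 4 _≲_

-- Order of representing sequences at every index, stronger than `Real.≤`. All summands of a row are
-- constant sequences, so it applies without an error term.
_≲_ : Rel ℝ 0ℓ
x ≲ y = ∀ k → Real.seq x k ℚ.≤ Real.seq y k

≤-≲-trans : ∀ {x y z} → x Real.≤ y → y ≲ z → x Real.≤ z
≤-≲-trans x≤y y≲z e 0<e =
  let N , x<y+e = x≤y e 0<e
  in N , λ k N≤k → ℚ.<-≤-trans (x<y+e k N≤k) (ℚ.+-monoˡ-≤ e (y≲z k))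

sum-mono-≲ : ∀ {n} {u v : Vector ℝ n} → (∀ j → u j ≲ v j) → Real.sum u ≲ Real.sum v
sum-mono-≲ {zero}  u≲v k = ℚ.≤-refl
sum-mono-≲ {suc n} u≲v k = ℚ.+-mono-≤ (u≲v zero k) (sum-mono-≲ (u≲v ∘ suc) k)

row-mono : ∀ {m n d} {A : Matrix (Fin m) (Fin n)} {b : Vector ℝ m} i {u v : Vec (D d) n} →
  (∀ j → A i j Real.* Real.fromℕ (toℕ (lookup u j)) ≲ A i j Real.* Real.fromℕ (toℕ (lookup v j))) →
  (A · u) i Real.≥ b i → (A · v) i Real.≥ b i
row-mono {n = n} {d} {A} {b} i {u} {v} u≲v Au≥b =
  ≤-≲-trans {b i} {(A · u) i} {(A · v) i} Au≥b
    (sum-mono-≲ {u = summands u} {v = summands v} u≲v)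
  where
  summands : Vec (D d) n → Vector ℝ n
  summands x j = A i j Real.* Real.fromℕ (toℕ (lookup x j))

term : ℚ → ∀ {d} → D d → ℝ
term c a = Real.fromℚ c Real.* Real.fromℕ (toℕ a)

zero-term : ∀ {d} (a a′ : D d) → term 0ℚ a ≲ term 0ℚ a′
zero-term a a′ _ = ℚ.≤-reflexive
  (trans (ℚ.*-zeroˡ (+ toℕ a ℚ./ 1)) (sym (ℚ.*-zeroˡ (+ toℕ a′ ℚ./ 1))))

eq-term : ∀ c {d} {a a′ : D d} → a ≡ a′ → term c a ≲ term c a′
eq-term c refl _ = ℚ.≤-refl

pos-term : ∀ {d} {a a′ : D d} → a Fin.≤ a′ → term 1ℚ a ≲ term 1ℚ a′
pos-term a≤a′ _ = ℚ.*-monoˡ-≤-nonNeg 1ℚ (fromℕ-mono-≤ a≤a′)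

neg-term : ∀ {d} {a a′ : D d} → a Fin.≤ a′ → term (ℚ.- 1ℚ) a′ ≲ term (ℚ.- 1ℚ) a
neg-term a≤a′ _ = ℚ.*-monoˡ-≤-nonPos (ℚ.- 1ℚ) (fromℕ-mono-≤ a≤a′)

-- Obstruction to elimination orderings

0<1 : Real.0ℝ Real.< Real.fromℚ 1ℚ
0<1 = ½ , ℚ.positive⁻¹ ½ , 0 , λ _ _ → from-yes (0ℚ ℚ.+ ½ ℚ.<? 1ℚ)

-1<0 : Real.fromℚ (ℚ.- 1ℚ) Real.< Real.0ℝ
-1<0 = ½ , ℚ.positive⁻¹ ½ , 0 , λ _ _ → from-yes (ℚ.- 1ℚ ℚ.+ ½ ℚ.<? 0ℚ)

1≉0 : ¬ Real.fromℚ 1ℚ Real.≈ Real.0ℝ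
1≉0 1≈0 = let N , 1<1 = 1≈0 1ℚ (ℚ.positive⁻¹ 1ℚ) in ℚ.<-irrefl refl (1<1 N ℕ.≤-refl)

-1≉0 : ¬ Real.fromℚ (ℚ.- 1ℚ) Real.≈ Real.0ℝ
-1≉0 -1≈0 = let N , 1<1 = -1≈0 1ℚ (ℚ.positive⁻¹ 1ℚ) in ℚ.<-irrefl refl (1<1 N ℕ.≤-refl)

-- Both clauses of elimination fail at each column of `C`, with the witness column `j′` again in
-- `C`, so deleting columns outside `C` cannot repair them.
Locked : ∀ {m n} → Matrix (Fin m) (Fin n) → Pred (Fin n) 0ℓ → Set
Locked A C = ∀ {j} → j ∈ C →
    (∃₂ λ i j′ → j′ ∈ C × j′ ≢ j × A i j Real.> Real.0ℝ × ¬ A i j′ Real.≈ Real.0ℝ)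
  × (∃₂ λ i j′ → j′ ∈ C × j′ ≢ j × A i j Real.< Real.0ℝ × ¬ A i j′ Real.≈ Real.0ℝ)

-- The first column of C in an elimination ordering cannot be eliminated,
-- because all of C is still present at that stage.
locked⇒noEO : ∀ {m n} {A : Matrix (Fin m) (Fin n)} {C} → Locked A C → ∃ (_∈ C) →
  ¬ HasEliminationOrdering A
locked⇒noEO {A = A} {C} locked (j , j∈C) (σ , elim) =
  avoids (σ ⟨$⟩ˡ j) (<-wellFounded _) (subst C (sym (inverseʳ σ)) j∈C)
  where
  avoids : ∀ t → Acc Fin._<_ t → σ ⟨$⟩ʳ t ∉ C
  avoids t (acc rec) σt∈C with elim t | locked σt∈C
  ... | inj₁ zeros | (i , j′ , j′∈C , j′≢σt , pos , nonzero) , _ =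
    nonzero (zeros i pos
      (j′ , [ (λ (s , s<t , σs≡j′) → avoids s (rec s<t) (subst C (sym σs≡j′) j′∈C)) ])
      (j′≢σt ∘ cong value))
  ... | inj₂ zeros | _ , (i , j′ , j′∈C , j′≢σt , neg , nonzero) =
    nonzero (zeros i neg
      (j′ , [ (λ (s , s<t , σs≡j′) → avoids s (rec s<t) (subst C (sym σs≡j′) j′∈C)) ])
      (j′≢σt ∘ cong value))

-- Walks in solution graphs

Walk : ∀ {n d} → Pred (Vec (D d) n) 0ℓ → Rel (Vec (D d) n) 0ℓ
Walk S = Star (λ u v → u ∈ S × v ∈ S × DifferInExactlyOne u v)

walk-sym : ∀ {n d} {S : Pred (Vec (D d) n) 0ℓ} {p q} → Walk S p q → Walk S q p
walk-sym {S = S} = reverse λ {u} {v} (u∈S , v∈S , adj) →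
  v∈S , u∈S , Graph.Adj-sym (G S) {u} {v} adj

-- `r` is an initial segment of `p` continued by the rest of `q`: the points met when `p` is turned
-- into `q` from the last coordinate to the first.
data Splice {d} : ∀ {n} → (p q r : Vec (D d) n) → Set where
  here  : ∀ {n} {p q : Vec (D d) n} → Splice p q q
  there : ∀ {n a b} {p q r : Vec (D d) n} →
          Splice p q r → Splice (a ∷ p) (b ∷ q) (a ∷ r)

splices⇒walk : ∀ {n d} {S : Pred (Vec (D d) n) 0ℓ} (p q : Vec (D d) n) →
  (∀ {r} → Splice p q r → r ∈ S) → Walk S p q
splices⇒walk []      []      _     = ε
splices⇒walk {S = S} (a ∷ p) (b ∷ q) ⊆S =
  gmap (a ∷_) (λ (u∈S , v∈S , adj) → u∈S , v∈S , adj-∷ adj)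
    (splices⇒walk p q (⊆S ∘ there))
  ◅◅ head-step
  where
  adj-∷ : ∀ {u v} → DifferInExactlyOne u v → DifferInExactlyOne (a ∷ u) (a ∷ v)
  adj-∷ {u} {v} (j , u≢v , unique) = suc j , u≢v , unique-∷ _
    where
    unique-∷ : ∀ k → lookup (a ∷ u) k ≢ lookup (a ∷ v) k → suc j ≡ k
    unique-∷ zero    a≢a = contradiction refl a≢a
    unique-∷ (suc k) u≢v = cong suc (unique u≢v)
  only-head : ∀ k → lookup (a ∷ q) k ≢ lookup (b ∷ q) k → zero ≡ k
  only-head zero    _   = refl
  only-head (suc k) q≢q = contradiction refl q≢q
  head-step : Walk S (a ∷ q) (b ∷ q)
  -- Adjacency needs an actual difference, so equal heads give the empty walk.
  head-step with a Fin.≟ b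
  ... | yes refl = ε
  ... | no  a≢b  = (⊆S (there here) , ⊆S here , zero , a≢b , only-head _) ◅ ε

-- With coordinates 0, 1, 2 as x, y, z: if f(x) ≤ y₁ ≤ y ≤ y₂ ≤ g(z), then
-- f(x) ≤ y ≤ g(z).
BetweenClosed : ∀ {n d} → Pred (Vec (D d) (3 ℕ.+ n)) 0ℓ → Set
BetweenClosed S = ∀ u v r → u ∈ S → v ∈ S →
  lookup u 0F ≡ lookup r 0F → lookup u 1F Fin.≤ lookup r 1F →
  lookup v 2F ≡ lookup r 2F → lookup r 1F Fin.≤ lookup v 1F →
  r ∈ S

-- Walks can be reversed, so the endpoints may be ordered by `y`. Splicing then changes `z` before
-- `y` and `y` before `x`.
betweenClosed⇒connected : ∀ {n d} {S : Pred (Vec (D d) (3 ℕ.+ n)) 0ℓ} →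
  BetweenClosed S → Connected (G S)
betweenClosed⇒connected {S = S} between {p} {q} p∈S q∈S =
  [ walk p∈S q∈S , walk-sym ∘ walk q∈S p∈S ]′ (Fin.≤-total (lookup p 1F) (lookup q 1F))
  where
  walk : ∀ {p q} → p ∈ S → q ∈ S → lookup p 1F Fin.≤ lookup q 1F → Walk S p q
  walk {x ∷ y ∷ z ∷ w} {x′ ∷ y′ ∷ z′ ∷ w′} p∈S q∈S y≤y′ = splices⇒walk _ _ λ where
    here                      → q∈S
    (there here)              → between _ _ _ p∈S q∈S refl y≤y′ refl ℕ.≤-refl
    (there (there here))      → between _ _ _ p∈S q∈S refl ℕ.≤-refl refl y≤y′
    -- Here `x`, `y`, `z` are still those of `p`, and `BetweenClosed` leaves the later coordinates
    -- of `r` free.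
    (there (there (there _))) → between _ _ _ p∈S p∈S refl ℕ.≤-refl refl ℕ.≤-refl

-- The matrix and its two properties

module Construction (m n : ℕ) where

  coeff : Fin (4 ℕ.+ m) → Fin (3 ℕ.+ n) → ℚ
  coeff 0F 0F = 1ℚ
  coeff 0F 1F = 1ℚ
  coeff 1F 0F = ℚ.- 1ℚ
  coeff 1F 1F = 1ℚ
  coeff 2F 1F = ℚ.- 1ℚ
  coeff 2F 2F = 1ℚ
  coeff 3F 1F = ℚ.- 1ℚ
  coeff 3F 2F = ℚ.- 1ℚ
  -- This also pads the matrix: rows after the fourth and columns after the third vanish.
  coeff _  _  = 0ℚ

  A : Matrix (Fin (4 ℕ.+ m)) (Fin (3 ℕ.+ n))
  A i j = Real.fromℚ (coeff i j)

  -- Column `y` blocks `x` and `z` for both signs; `y` itself is blocked by `x` for the positive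
  -- sign and by `z` for the negative one.
  locked : Locked A (λ j → toℕ j ℕ.< 3)
  locked {0F} _ =
      (0F , 1F , s≤s (s≤s z≤n) , (λ ()) , 0<1 , 1≉0)
    , (1F , 1F , s≤s (s≤s z≤n) , (λ ()) , -1<0 , 1≉0)
  locked {1F} _ =
      (0F , 0F , s≤s z≤n , (λ ()) , 0<1 , 1≉0)
    , (2F , 2F , s≤s (s≤s (s≤s z≤n)) , (λ ()) , -1<0 , 1≉0)
  locked {2F} _ =
      (2F , 1F , s≤s (s≤s z≤n) , (λ ()) , 0<1 , -1≉0)
    , (3F , 1F , s≤s (s≤s z≤n) , (λ ()) , -1<0 , -1≉0)
  locked {suc (suc (suc _))} (s≤s (s≤s (s≤s ())))

  noEO : ¬ HasEliminationOrdering A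
  noEO = locked⇒noEO {A = A} {C = λ j → toℕ j ℕ.< 3} locked (0F , s≤s z≤n)

  module _ {d : ℕ} (b : Vector ℝ (4 ℕ.+ m)) where

    -- Rows `0F` and `1F` increase with `y` and ignore `z`, so they pass from `u` to `r`; rows `2F`
    -- and `3F` decrease with `y` and ignore `x`, so they pass from `v` to `r`.
    between : BetweenClosed (R d A b)
    between u v r u∈R v∈R ux≡rx uy≤ry vz≡rz ry≤vy 0F = row-mono {A = A} {b} 0F {u} {r} (λ where
      0F → eq-term (coeff 0F 0F) ux≡rx
      1F → pos-term uy≤ry
      2F → zero-term (lookup u 2F) (lookup r 2F)
      j@(suc (suc (suc _))) → zero-term (lookup u j) (lookup r j)) (u∈R 0F)
    between u v r u∈R v∈R ux≡rx uy≤ry vz≡rz ry≤vy 1F = row-mono {A = A} {b} 1F {u} {r} (λ where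
      0F → eq-term (coeff 1F 0F) ux≡rx
      1F → pos-term uy≤ry
      2F → zero-term (lookup u 2F) (lookup r 2F)
      j@(suc (suc (suc _))) → zero-term (lookup u j) (lookup r j)) (u∈R 1F)
    between u v r u∈R v∈R ux≡rx uy≤ry vz≡rz ry≤vy 2F = row-mono {A = A} {b} 2F {v} {r} (λ where
      0F → zero-term (lookup v 0F) (lookup r 0F)
      1F → neg-term ry≤vy
      2F → eq-term (coeff 2F 2F) vz≡rz
      j@(suc (suc (suc _))) → zero-term (lookup v j) (lookup r j)) (v∈R 2F)
    between u v r u∈R v∈R ux≡rx uy≤ry vz≡rz ry≤vy 3F = row-mono {A = A} {b} 3F {v} {r} (λ where
      0F → zero-term (lookup v 0F) (lookup r 0F)
      1F → neg-term ry≤vy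
      2F → eq-term (coeff 3F 2F) vz≡rz
      j@(suc (suc (suc _))) → zero-term (lookup v j) (lookup r j)) (v∈R 3F)
    -- A padding row has the same value at every point, so feasibility of `u` suffices.
    between u v r u∈R v∈R ux≡rx uy≤ry vz≡rz ry≤vy i@(suc (suc (suc (suc _)))) =
      row-mono {A = A} {b} i {u} {r} (λ j → zero-term (lookup u j) (lookup r j)) (u∈R i)

    connected : Connected (G (R d A b))
    connected {p} {q} = betweenClosed⇒connected {S = R d A b} between {p} {q}

theorem1 : (m n d : ℕ) → 4 ≤ m → 3 ≤ n → 1 ≤ d →
    ∃ λ (A : Matrix (Fin m) (Fin n)) →
    ¬ HasEliminationOrdering A ×
    ((b : Vector ℝ m) → Connected (G (R d A b)))
theorem1 _ _ d (s≤s (s≤s (s≤s (s≤s {n = m} _)))) (s≤s (s≤s (s≤s {n = n} _))) _ =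
  A , noEO , connected
  where open Construction m n
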